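{- Let $n\ge 1$ and let $f_1,\ldots,f_n$ be reversible cellular automata on $\Sigma^{\mathbb Z}$. Then $$\mathcal{BN}(f_n\cdots f_1)\subseteq\bigcup_{k=1}^n\Bigl(\tilde{\mathcal N}(f_n\cdots f_{k+1})+\mathcal{BN}(f_k)+\mathcal N(f_{k-1}\cdots f_1)\Bigr),$$ where empty compositions (namely $f_n\cdots f_{k+1}$ for $k=n$ and $f_{k-1}\cdots f_1$ for $k=1$) denote the identity.
   Context: $\Sigma$ is a finite nonempty alphabet. A (one-dimensional) cellular automaton (CA) on $\Sigma$ is a translation-invariant map $f:\Sigma^{\mathbb Z}\to\Sigma^{\mathbb Z}$ for which $f(v)_0$ depends only on finitely many coordinates of $v$; it is reversible if it is bijective (its inverse is then also a CA). $fg$ denotes the composition $f\circ g$. For $P,Q\subseteq\mathbb Z$, $P+Q=\{p+q\mid p\in P,q\in Q\}$. For $X\subseteq\mathbb Z$, $\bar X=\mathbb Z\setminus X$, and $\Sigma^{\mathbb Z}$ is identified with $\Sigma^X\times\Sigma^{\bar X}$. Neighborhoods: $\mathcal N(f)$ is the smallest $A\subseteq\mathbb Z$ such that $v|_A$ determines $f(v)_0$. The dual of a reversible CA $f$ is $\tilde f=S f^{ -1}S$, where $S(a)_n=a_{ -n}$ on $\Sigma^{\mathbb Z}$, and the dual neighborhood is $\tilde{\mathcal N}(f)=\mathcal N(\tilde f)$. Semilocalizable: a bijection $F:A\times B\to C\times D$ is semilocalizable if there exist a set $E$ and bijections $g:A\to C\times E$ and $h:D\to B\times E$ such that for all $a\in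 A,b\in B$, $F(a,b)=\bigl(g_C(a),\,h^{ -1}(b,g_E(a))\bigr)$, where $g(a)=(g_C(a),g_E(a))$. For $X,Y\subseteq\mathbb Z$, $\mathbf{Q}_X^Y(f)$ is the property: "$f$, seen as a function from $\Sigma^X\times\Sigma^{\bar X}$ to $\Sigma^Y\times\Sigma^{\bar Y}$, is semilocalizable". The block neighborhood $\mathcal{BN}(f)$ is the smallest (for inclusion) $X\subseteq\mathbb Z$ such that $\mathbf{Q}_X^{\{0\}}(f)$ holds. -}

module Defs where

open import Data.Bool.Base using (Bool; true; false; not; T)
open import Data.Fin.Base using (Fin; toℕ)
open import Data.Integer.Base using (ℤ; 0ℤ; _+_; -_)
open import Data.Integer.Properties using (_≟_)
open import Data.List.Base using (List; []; _∷_; tabulate; take; drop)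
open import Data.List.Membership.Propositional using (_∈_)
open import Data.Nat.Base using (ℕ; suc)
open import Data.Product.Base using (Σ-syntax; ∃-syntax; _×_; _,_; proj₁; proj₂)
open import Data.Product.Relation.Binary.Pointwise.NonDependent using (_×ₛ_)
open import Data.Unit.Base using (tt)
open import Function.Base using (_∘_)
open import Function.Bundles using (Inverse)
import Function.Construct.Composition as Composition
import Function.Construct.Identity as Identity
import Function.Construct.Symmetry as Symmetry
open import Level using (Level; 0ℓ) renaming (suc to lsuc)
open import Relation.Binary.Bundles using (Setoid)
open import Relation.Binary.PropositionalEquality
  using (_≡_; _≗_; refl; sym; trans; _→-setoid_)
open import Relation.Nullary.Decidable.Core using (⌊_⌋)
open import Relation.Unary using (Pred; _⊆_)

private
  variable
    ℓ : Level

-- Subsets of ℤ are Bool-valued: Σ^ℤ ≅ Σ^X × Σ^(∁ X) needs membership in X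
-- to be decidable.
Subset : Set
Subset = ℤ → Bool

⟦_⟧ : Subset → Pred ℤ 0ℓ
⟦ X ⟧ z = T (X z)

∁ : Subset → Subset
∁ X z = not (X z)

｛0｝ : Subset
｛0｝ z = ⌊ z ≟ 0ℤ ⌋

infixl 6 _⊕_

_⊕_ : Pred ℤ 0ℓ → Pred ℤ 0ℓ → Pred ℤ 0ℓ
(P ⊕ Q) z = ∃[ p ] ∃[ q ] (P p × Q q × z ≡ p + q)

IsSmallest : (Subset → Set ℓ) → Subset → Set ℓ
IsSmallest P X = P X × (∀ Y → P Y → ⟦ X ⟧ ⊆ ⟦ Y ⟧)

-- Functions are compared pointwise, so the "sets" here, including the
-- auxiliary E, are setoids and the bijections are setoid bijections.
record Semilocalizable {A B C D : Setoid 0ℓ 0ℓ}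
                       (F : Inverse (A ×ₛ B) (C ×ₛ D)) : Set (lsuc 0ℓ) where
  private
    module A = Setoid A
    module B = Setoid B
    module CD = Setoid (C ×ₛ D)
  field
    E : Setoid 0ℓ 0ℓ
    g : Inverse A (C ×ₛ E)
    h : Inverse D (B ×ₛ E)
    factor : ∀ (a : A.Carrier) (b : B.Carrier) →
             Inverse.to F (a , b) CD.≈
               ( proj₁ (Inverse.to g a)
               , Inverse.from h (b , proj₂ (Inverse.to g a)) )

module _ (A : Set) where

  Config : Set
  Config = ℤ → A

  ConfigSetoid : Setoid 0ℓ 0ℓ
  ConfigSetoid = ℤ →-setoid A

  Restricted : Subset → Setoid 0ℓ 0ℓ
  Restricted X = (Σ[ z ∈ ℤ ] ⟦ X ⟧ z) →-setoid A

  BijectiveMap : Set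
  BijectiveMap = Inverse ConfigSetoid ConfigSetoid

module _ {A : Set} where

  private
    glue : (c : Bool) → (T c → A) → (T (not c) → A) → A
    glue true  a b = a tt
    glue false a b = b tt

    glue-cong : ∀ c {a a′ : T c → A} {b b′ : T (not c) → A} →
                a ≗ a′ → b ≗ b′ → glue c a b ≡ glue c a′ b′
    glue-cong true  p q = p tt
    glue-cong false p q = q tt

    glue-in : ∀ c (a : T c → A) (b : T (not c) → A) t → glue c a b ≡ a t
    glue-in true a b tt = refl

    glue-out : ∀ c (a : T c → A) (b : T (not c) → A) t → glue c a b ≡ b t
    glue-out false a b tt = refl

    glue-const : ∀ c (x : A) → glue c (λ _ → x) (λ _ → x) ≡ x
    glue-const true  x = refl
    glue-const false x = refl

  split : (X : Subset) →
          Inverse (ConfigSetoid A) (Restricted A X ×ₛ Restricted A (∁ X))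
  split X = record
    { to        = λ v → v ∘ proj₁ , v ∘ proj₁
    ; from      = λ (a , b) z → glue (X z) (λ t → a (z , t)) (λ t → b (z , t))
    ; to-cong   = λ p → p ∘ proj₁ , p ∘ proj₁
    ; from-cong = λ (p , q) z →
                    glue-cong (X z) (λ t → p (z , t)) (λ t → q (z , t))
    ; inverse   =
        (λ e → (λ (z , t) → trans (e z) (glue-in  (X z) _ _ t))
             , (λ (z , t) → trans (e z) (glue-out (X z) _ _ t)))
      , (λ (p , q) z →
           trans (glue-cong (X z) (λ t → p (z , t)) (λ t → q (z , t)))
                 (glue-const (X z) _))
    }

  shift : ℤ → Config A → Config A
  shift k v z = v (z + k)

  reflect : Config A → Config A
  reflect v z = v (- z)

  Determines : Pred ℤ 0ℓ → (Config A → Config A) → Set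
  Determines P f =
    ∀ v w → (∀ z → P z → v z ≡ w z) → f v 0ℤ ≡ f w 0ℤ

  record IsCellularAutomaton (f : Config A → Config A) : Set where
    field
      translation-invariant : ∀ k v → f (shift k v) ≗ shift k (f v)
      local                 : ∃[ W ] Determines (_∈ W) f

  dual : BijectiveMap A → Config A → Config A
  dual f = reflect ∘ Inverse.from f ∘ reflect

  -- Q X Y f is the property 𝐐_X^Y(f).
  Q : Subset → Subset → BijectiveMap A → Set (lsuc 0ℓ)
  Q X Y f = Semilocalizable
    {Restricted A X} {Restricted A (∁ X)} {Restricted A Y} {Restricted A (∁ Y)}
    (Composition.inverse (Symmetry.inverse (split X))
      (Composition.inverse f (split Y)))

  IsNeighborhood : (Config A → Config A) → Subset → Set
  IsNeighborhood f = IsSmallest (λ X → Determines ⟦ X ⟧ f)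

  IsDualNeighborhood : BijectiveMap A → Subset → Set
  IsDualNeighborhood f = IsNeighborhood (dual f)

  IsBlockNeighborhood : BijectiveMap A → Subset → Set (lsuc 0ℓ)
  IsBlockNeighborhood f = IsSmallest (λ X → Q X ｛0｝ f)

  -- The head of the list is applied first.
  composeList : List (BijectiveMap A) → BijectiveMap A
  composeList []       = Identity.inverse (ConfigSetoid A)
  composeList (f ∷ fs) = Composition.inverse f (composeList fs)

  -- Indices start at 0: for f₀ , … , fₙ₋₁ these are fₙ₋₁ ⋯ f₀,
  -- fₖ₋₁ ⋯ f₀ and fₙ₋₁ ⋯ fₖ₊₁.
  composeAll : ∀ {n} → (Fin n → BijectiveMap A) → BijectiveMap A
  composeAll f = composeList (tabulate f)

  composeBefore composeAfter :
    ∀ {n} → (Fin n → BijectiveMap A) → Fin n → BijectiveMap A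
  composeBefore f k = composeList (take (toℕ k) (tabulate f))
  composeAfter  f k = composeList (drop (suc (toℕ k)) (tabulate f))

{-# OPTIONS --safe #-}

-- Say that f overwrites D within S if changing f v on D to given values
-- amounts to changing v inside S only, to new values that depend on v inside
-- S only. The property 𝐐_X^{0} turns out to say that f overwrites {0} within
-- X: the set E is Σ^X modulo having the same effect on the outputs other
-- than 0.
--
-- Now overwrite coordinate 0 of fₙ ⋯ f₁ v and pull the change back one map at
-- a time. After undoing fₙ ⋯ fₖ₊₁ it is confined to the dual neighborhood Ñₖ
-- of that composition, so undoing fₖ confines it to Ñₖ + BN(fₖ), and the new
-- values depend on fₖ₋₁ ⋯ f₁ v there, that is, on v in Ñₖ + BN(fₖ) + Nₖ.
-- Hence fₙ ⋯ f₁ overwrites {0} within the union of these sets.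
--
-- The union has to be decidable, and the changes are made one cell at a time,
-- so Ñₖ must be finite: the inverse of a bijective CA is local. In place of
-- compactness there is a pigeonhole argument. If f v and f w agree on a long
-- interval, then some pair of windows of v and w repeats in it; continuing
-- both periodically and using injectivity, v and w agree on that window.
-- With one such window on either side of 0, replacing v by w in between does
-- not change f v, so v and w agree in between.

module Submission where

open import Defs
open import Data.Bool.Base using (true; false)
open import Data.Bool.Properties using (T?)
open import Data.Fin.Base using (Fin; zero; suc; toℕ; fromℕ; fromℕ<; inject₁; combine; funToFin; finToFun)
open import Data.Fin.Induction using (>-weakInduction)
open import Data.Fin.Properties
  using (any?; pigeonhole; combine-injective; finToFun-funToFin; toℕ-fromℕ; toℕ-fromℕ<; toℕ-inject₁; toℕ<n)
open import Data.Integer.Base as ℤ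
  using (ℤ; 0ℤ; 1ℤ; +_; -[1+_]; _+_; _-_; -_; _*_; ∣_∣; _%ℕ_; _/ℕ_)
import Data.Integer.DivMod as ℤ
import Data.Integer.Properties as ℤ
open import Data.Integer.Tactic.RingSolver using (solve-∀)
open import Data.List.Base
  using (List; []; _∷_; map; filter; take; drop; tabulate; upTo; cartesianProductWith)
open import Data.List.Membership.DecPropositional ℤ._≟_ using (_∈?_)
open import Data.List.Membership.Propositional using (_∈_; find; lose)
open import Data.List.Membership.Propositional.Properties
  using (∈-map⁺; ∈-upTo⁺; ∈-filter⁺; ∈-filter⁻; ∈-cartesianProductWith⁺)
open import Data.List.Relation.Unary.All using (All; []; _∷_)
import Data.List.Relation.Unary.All.Properties as All
open import Data.List.Relation.Unary.Any as Any using (here; there)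
open import Data.Nat.Base as ℕ using (ℕ; zero; suc; NonZero; _^_; _⊔_; _≤_; _<_)
open import Data.Nat.Divisibility using (_∣_; ∣⇒≤; divides)
import Data.Nat.DivMod as ℕ
open import Data.Nat.Induction using (<-rec)
import Data.Nat.Properties as ℕ
open import Data.Product.Base using (∃-syntax; _×_; _,_; proj₁; proj₂)
open import Data.Product.Relation.Binary.Pointwise.NonDependent using (_×ₛ_)
open import Data.Sum.Base using (_⊎_; inj₁; inj₂)
open import Function.Base using (_∘_; case_of_)
open import Function.Bundles using (_↔_; Inverse)
import Function.Construct.Composition as Composition
import Function.Construct.Symmetry as Symmetry
open import Level using (0ℓ)
open import Relation.Binary.Bundles using (Setoid)
open import Relation.Binary.PropositionalEquality
open import Relation.Nullary.Decidable
  using (yes; no; ⌊_⌋; _×-dec_; map′; toWitness; fromWitness)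
open import Relation.Nullary.Negation.Core using (¬_; contradiction)
open import Relation.Unary using (Pred; Decidable; _⊆_; ⋃)

-- Locality of the inverse

bounded : (W : List ℤ) → ∃[ R ] (∀ {x} → x ∈ W → ∣ x ∣ ≤ R)
bounded []      = 0 , λ ()
bounded (x ∷ W) with bounded W
... | R , W≤R = ∣ x ∣ ⊔ R , λ where
  (here refl) → ℕ.m≤m⊔n ∣ x ∣ R
  (there y∈W) → ℕ.≤-trans (W≤R y∈W) (ℕ.m≤n⊔m ∣ x ∣ R)

translate-nonNegative : ∀ x {R} → ∣ x ∣ ≤ R → ∃[ t ] (t < suc (R ℕ.+ R) × x + + R ≡ + t)
translate-nonNegative (+ n)    n≤R = _ , ℕ.s≤s (ℕ.+-monoˡ-≤ _ n≤R) , refl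
translate-nonNegative -[1+ n ] {R} n<R =
  _ , ℕ.s≤s (ℕ.≤-trans (ℕ.m∸n≤m R (suc n)) (ℕ.m≤m+n R R)) , ℤ.⊖-≥ n<R

≤⇒+ : ∀ {x y} → x ℤ.≤ y → ∃[ n ] y ≡ x + + n
≤⇒+ {x} {y} x≤y = ∣ y - x ∣ , (begin
  y                ≡⟨ lemma y x ⟩
  x + (y - x)      ≡⟨ cong (_+_ x) (ℤ.0≤i⇒+∣i∣≡i (ℤ.i≤j⇒0≤j-i x≤y)) ⟨
  x + + ∣ y - x ∣  ∎)
  where
  open ≡-Reasoning
  lemma : ∀ y x → y ≡ x + (y - x)
  lemma = solve-∀

[z-k]+k : ∀ z k → z - k + k ≡ z
[z-k]+k = solve-∀

multiple<⇒≡0 : ∀ {m n} → m ∣ n → n < m → n ≡ 0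
multiple<⇒≡0 {n = zero}  _   _   = refl
multiple<⇒≡0 {n = suc n} m∣n n<m = contradiction (∣⇒≤ m∣n) (ℕ.<⇒≱ n<m)

-- Two remainders differ by a multiple of `p` whose absolute value is below `p`, hence by 0.
%ℕ-unique : ∀ z p .{{_ : NonZero p}} {r} q → r < p → z ≡ + r + q * + p → z %ℕ p ≡ r
%ℕ-unique z p {r} q r<p z≡ = ℤ.+-injective (ℤ.i-j≡0⇒i≡j _ _ (ℤ.∣i∣≡0⇒i≡0
  (multiple<⇒≡0 (divides ∣ q - q′ ∣ multiple) (ℕ.≤-<-trans bound (ℕ.⊔-pres-<m (ℤ.n%ℕd<d z p) r<p)))))
  where
  open ≡-Reasoning
  r′ = z %ℕ p
  q′ = z /ℕ p

  lemma : ∀ z r′ r q q′ p → z ≡ r′ + q′ * p → z ≡ r + q * p → r′ - r ≡ (q - q′) * p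
  lemma z r′ r q q′ p e e′ = begin
    r′ - r                              ≡⟨ eq₁ r′ r (q′ * p) ⟩
    r′ + q′ * p - (r + q′ * p)          ≡⟨ cong (_- (r + q′ * p)) (trans (sym e) e′) ⟩
    r + q * p - (r + q′ * p)            ≡⟨ eq₂ r q q′ p ⟩
    (q - q′) * p                        ∎
    where
    eq₁ : ∀ a b c → a - b ≡ a + c - (b + c)
    eq₁ = solve-∀
    eq₂ : ∀ r q q′ p → r + q * p - (r + q′ * p) ≡ (q - q′) * p
    eq₂ = solve-∀

  multiple : ∣ + r′ - + r ∣ ≡ ∣ q - q′ ∣ ℕ.* p
  multiple = trans (cong ∣_∣ (lemma z (+ r′) (+ r) q q′ (+ p) (ℤ.a≡a%ℕn+[a/ℕn]*n z p) z≡))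
                   (ℤ.∣i*j∣≡∣i∣*∣j∣ (q - q′) (+ p))

  bound : ∣ + r′ - + r ∣ ≤ r′ ⊔ r
  bound = subst (λ i → ∣ i ∣ ≤ r′ ⊔ r) (sym (ℤ.[+m]-[+n]≡m⊖n r′ r)) (ℤ.∣m⊝n∣≤m⊔n r′ r)

%ℕ-distribˡ-+ : ∀ z t p .{{_ : NonZero p}} → (z + + t) %ℕ p ≡ (z %ℕ p ℕ.+ t) ℕ.% p
%ℕ-distribˡ-+ z t p = %ℕ-unique (z + + t) p (z /ℕ p + + (s ℕ./ p)) (ℕ.m%n<n s p) (begin
  z + + t
    ≡⟨ cong (_+ + t) (ℤ.a≡a%ℕn+[a/ℕn]*n z p) ⟩
  + r + q * + p + + t
    ≡⟨ lemma₁ (+ r) (q * + p) (+ t) ⟩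
  + s + q * + p
    ≡⟨ cong (_+ q * + p) (ℤ.a≡a%ℕn+[a/ℕn]*n (+ s) p) ⟩
  + (s ℕ.% p) + + (s ℕ./ p) * + p + q * + p
    ≡⟨ lemma₂ (+ (s ℕ.% p)) (+ (s ℕ./ p)) q (+ p) ⟩
  + (s ℕ.% p) + (q + + (s ℕ./ p)) * + p
    ∎)
  where
  open ≡-Reasoning
  r = z %ℕ p
  q = z /ℕ p
  s = r ℕ.+ t
  lemma₁ : ∀ a b c → a + b + c ≡ a + c + b
  lemma₁ = solve-∀
  lemma₂ : ∀ a b c d → a + b * d + c * d ≡ a + (c + b) * d
  lemma₂ = solve-∀

-- Windows, periodic continuation and splicing

module _ {A : Set} where

  -- A window is indexed by natural numbers from its left end, and `k` is the offset of the output
  -- it determines. Comparing windows at two places `z` and `z′` builds in translation invariance: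
  -- the windows of a periodic configuration are going to be found elsewhere in `v`.
  Windowed : ℤ → ℕ → (Config A → Config A) → Set
  Windowed k L f = ∀ v w z z′ →
    (∀ {t} → t < L → v (z + + t) ≡ w (z′ + + t)) → f v (z + k) ≡ f w (z′ + k)

  windowed : ∀ {f : Config A → Config A} → IsCellularAutomaton f →
             ∃[ k ] ∃[ L ] Windowed k L f
  windowed {f} ca with IsCellularAutomaton.local ca
  ... | W , det with bounded W
  -- A neighborhood inside [-R, R] becomes a window of length 2R + 1 with the output at its centre.
  ... | R , W≤R = + R , suc (R ℕ.+ R) , λ v w z z′ eq → begin
    f v (z + + R)                  ≡⟨ cong (f v) (ℤ.+-identityˡ _) ⟨
    f v (0ℤ + (z + + R))           ≡⟨ translation-invariant (z + + R) v 0ℤ ⟨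
    f (shift (z + + R) v) 0ℤ       ≡⟨ det _ _ (agree v w z z′ eq) ⟩
    f (shift (z′ + + R) w) 0ℤ      ≡⟨ translation-invariant (z′ + + R) w 0ℤ ⟩
    f w (0ℤ + (z′ + + R))          ≡⟨ cong (f w) (ℤ.+-identityˡ _) ⟩
    f w (z′ + + R)                 ∎
    where
    open ≡-Reasoning
    open IsCellularAutomaton ca

    swap : ∀ x z r → x + (z + r) ≡ z + (x + r)
    swap = solve-∀

    agree : ∀ v w z z′ →
            (∀ {t} → t < suc (R ℕ.+ R) → v (z + + t) ≡ w (z′ + + t)) →
            ∀ x → x ∈ W → shift (z + + R) v x ≡ shift (z′ + + R) w x
    agree v w z z′ eq x x∈W with translate-nonNegative x (W≤R x∈W)
    ... | t , t<L , x+R≡t = begin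
      v (x + (z + + R))   ≡⟨ cong v (trans (swap x z (+ R)) (cong (_+_ z) x+R≡t)) ⟩
      v (z + + t)         ≡⟨ eq t<L ⟩
      w (z′ + + t)        ≡⟨ cong w (trans (swap x z′ (+ R)) (cong (_+_ z′) x+R≡t)) ⟨
      w (x + (z′ + + R))  ∎

  -- Coordinates are counted from `i`: the repeated block is moved to the positions 0 to p - 1.
  periodic : Config A → ℤ → (p : ℕ) .{{_ : NonZero p}} → Config A
  periodic v i p z = v (i + + (z %ℕ p))

  -- Since the window at `i` recurs at `i + p`, `v` itself continues periodically for `L` cells
  -- after the first block. The induction is strong because `L` may exceed `p`, so that one step
  -- back by `p` need not reach the first block.
  periodic-agrees : ∀ v i p .{{_ : NonZero p}} L →
                    (∀ {t} → t < L → v (i + + t) ≡ v (i + + p + + t)) →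
                    ∀ n → n < p ℕ.+ L → periodic v i p (+ n) ≡ v (i + + n)
  periodic-agrees v i p L eq = <-rec _ step
    where
    open ≡-Reasoning
    step : ∀ n → (∀ {m} → m < n → m < p ℕ.+ L → periodic v i p (+ m) ≡ v (i + + m)) →
           n < p ℕ.+ L → periodic v i p (+ n) ≡ v (i + + n)
    step n rec n<p+L with n ℕ.<? p
    ... | yes n<p = cong (λ r → v (i + + r)) (ℕ.m<n⇒m%n≡m n<p)
    ... | no  n≮p with ℕ.m≤n⇒∃[o]m+o≡n (ℕ.≮⇒≥ n≮p)
    ...   | m , refl = begin
      v (i + + ((p ℕ.+ m) ℕ.% p))  ≡⟨ cong (λ r → v (i + + r)) [p+m]%p≡m%p ⟩
      v (i + + (m ℕ.% p))          ≡⟨ rec (ℕ.m<n+m m (ℕ.>-nonZero⁻¹ p)) (ℕ.<-≤-trans m<L (ℕ.m≤n+m L p)) ⟩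
      v (i + + m)                  ≡⟨ eq m<L ⟩
      v (i + + p + + m)            ≡⟨ cong v (ℤ.+-assoc i (+ p) (+ m)) ⟩
      v (i + + (p ℕ.+ m))          ∎
      where
      m<L = ℕ.+-cancelˡ-< p m L n<p+L
      [p+m]%p≡m%p = trans (cong (ℕ._% p) (ℕ.+-comm p m)) (ℕ.[m+n]%n≡m%n m p)

  -- Reducing `z` modulo `p` moves the window to a start in the first block; it then ends before
  -- `p + L`, where the continuation still coincides with `v`.
  periodic-window : ∀ v i p .{{_ : NonZero p}} L →
                    (∀ {t} → t < L → v (i + + t) ≡ v (i + + p + + t)) →
                    ∀ z {t} → t < L →
                    periodic v i p (z + + t) ≡ v (i + + (z %ℕ p) + + t)
  periodic-window v i p L eq z {t} t<L = begin
    v (i + + ((z + + t) %ℕ p))            ≡⟨ cong (λ r → v (i + + r)) (%ℕ-distribˡ-+ z t p) ⟩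
    periodic v i p (+ (z %ℕ p ℕ.+ t))     ≡⟨ periodic-agrees v i p L eq _ (ℕ.+-mono-< (ℤ.n%ℕd<d z p) t<L) ⟩
    v (i + + (z %ℕ p ℕ.+ t))              ≡⟨ cong v (ℤ.+-assoc i (+ (z %ℕ p)) (+ t)) ⟨
    v (i + + (z %ℕ p) + + t)              ∎
    where open ≡-Reasoning

  Injective : (Config A → Config A) → Set
  Injective f = ∀ {v w} → f v ≗ f w → v ≗ w

  -- If two windows at distance p repeat simultaneously in v and w, the
  -- p-periodic continuations of v and w have the same image.
  repetition⇒agree : ∀ {f k L} → Windowed k L f → Injective f →
    ∀ v w i p .{{_ : NonZero p}} →
    (∀ {t} → t < L → v (i + + t) ≡ v (i + + p + + t)) →
    (∀ {t} → t < L → w (i + + t) ≡ w (i + + p + + t)) →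
    (∀ {y} → y < p → f v (i + + y + k) ≡ f w (i + + y + k)) →
    ∀ {t} → t < L → v (i + + t) ≡ w (i + + t)
  repetition⇒agree {f} {k} {L} win inj v w i p eqv eqw eqf {t} t<L = begin
    v (i + + t)           ≡⟨ periodic-agrees v i p L eqv t (ℕ.<-≤-trans t<L (ℕ.m≤n+m L p)) ⟨
    periodic v i p (+ t)  ≡⟨ inj images (+ t) ⟩
    periodic w i p (+ t)  ≡⟨ periodic-agrees w i p L eqw t (ℕ.<-≤-trans t<L (ℕ.m≤n+m L p)) ⟩
    w (i + + t)           ∎
    where
    open ≡-Reasoning

    images′ : ∀ z → f (periodic v i p) (z + k) ≡ f (periodic w i p) (z + k)
    images′ z = begin
      f (periodic v i p) (z + k)    ≡⟨ win _ _ z (i + + (z %ℕ p)) (periodic-window v i p L eqv z) ⟩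
      f v (i + + (z %ℕ p) + k)      ≡⟨ eqf (ℤ.n%ℕd<d z p) ⟩
      f w (i + + (z %ℕ p) + k)      ≡⟨ win _ _ z (i + + (z %ℕ p)) (periodic-window w i p L eqw z) ⟨
      f (periodic w i p) (z + k)    ∎

    images : f (periodic v i p) ≗ f (periodic w i p)
    images z = subst (λ x → f (periodic v i p) x ≡ f (periodic w i p) x)
                     ([z-k]+k z k) (images′ (z - k))

  splice : ℤ → ℤ → Config A → Config A → Config A
  splice l r v w z with l ℤ.≤? z | z ℤ.<? r
  ... | yes _ | yes _ = w z
  ... | _     | _     = v z

  splice-inside : ∀ {l r z} v w → l ℤ.≤ z → z ℤ.< r → splice l r v w z ≡ w z
  splice-inside {l} {r} {z} v w l≤z z<r with l ℤ.≤? z | z ℤ.<? r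
  ... | yes _   | yes _   = refl
  ... | no  l≰z | _       = contradiction l≤z l≰z
  ... | yes _   | no  z≮r = contradiction z<r z≮r

  splice-agreeˡ : ∀ {l r z} v w → (l ℤ.≤ z → z ℤ.< r → v z ≡ w z) →
                  splice l r v w z ≡ v z
  splice-agreeˡ {l} {r} {z} v w eq with l ℤ.≤? z | z ℤ.<? r
  ... | yes l≤z | yes z<r = sym (eq l≤z z<r)
  ... | no  _   | _       = refl
  ... | yes _   | no  _   = refl

  splice-agreeʳ : ∀ {l r z} v w → l ℤ.≤ z → (r ℤ.≤ z → v z ≡ w z) →
                  splice l r v w z ≡ w z
  splice-agreeʳ {l} {r} {z} v w l≤z eq = case z ℤ.<? r of λ where
    (yes z<r) → splice-inside {l} v w l≤z z<r
    (no  z≮r) → trans (splice-agreeˡ {l} {r} v w (λ _ z<r → contradiction z<r z≮r)) (eq (ℤ.≮⇒≥ z≮r))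

  -- For `z ≤ x`, a coordinate `z + t` not left of `x` is at distance at most `t` from `x`, hence
  -- inside the window at `x`. This handles windows that straddle an end of a spliced interval.
  window-overlap : ∀ {L} (v w : Config A) x z → (∀ {t} → t < L → v (x + + t) ≡ w (x + + t)) →
                   z ℤ.≤ x → ∀ {t} → t < L → x ℤ.≤ z + + t →
                   v (z + + t) ≡ w (z + + t)
  window-overlap v w x z eq z≤x {t} t<L x≤z+t with ≤⇒+ z≤x | ≤⇒+ x≤z+t
  ... | n , refl | s , z+t≡z+n+s =
    subst (λ y → v y ≡ w y) (sym z+t≡z+n+s) (eq (ℕ.≤-<-trans s≤t t<L))
    where
    s≤t : s ≤ t
    s≤t = subst (s ≤_) (sym (ℤ.+-injective (+-cancelˡ (trans z+t≡z+n+s (ℤ.+-assoc z (+ n) (+ s)))))) (ℕ.m≤n+m s n)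
      where
      +-cancelˡ : ∀ {a b} → z + a ≡ z + b → a ≡ b
      +-cancelˡ {a} {b} e = trans (sym (lemma z a)) (trans (cong (_- z) e) (lemma z b))
        where
        lemma : ∀ z a → z + a - z ≡ a
        lemma = solve-∀

  -- Let `u` be `v` with `w` spliced in on [l, r). A window of `u` starting in the interval reads as
  -- one of `w`, any other as one of `v`; overruns past `l` or `r` are absorbed by the agreeing
  -- windows there. So `u` and `v` have the same image, and injectivity applies.
  agree-between : ∀ {f k L} → Windowed k L f → Injective f →
    ∀ v w l r →
    (∀ {t} → t < L → v (l + + t) ≡ w (l + + t)) →
    (∀ {t} → t < L → v (r + + t) ≡ w (r + + t)) →
    (∀ z → l ℤ.≤ z → z ℤ.< r → f v (z + k) ≡ f w (z + k)) →
    ∀ z → l ℤ.≤ z → z ℤ.< r → v z ≡ w z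
  agree-between {f} {k} {L} win inj v w l r eql eqr eqf z l≤z z<r =
    trans (sym (inj images z)) (splice-inside v w l≤z z<r)
    where
    u = splice l r v w

    images′ : ∀ z → f u (z + k) ≡ f v (z + k)
    images′ z with l ℤ.≤? z | z ℤ.<? r
    ... | yes l≤z | yes z<r = trans
      (win u w z z (λ {t} t<L → splice-agreeʳ {l} {r} v w (ℤ.≤-trans l≤z (ℤ.i≤i+j z (+ t)))
        (window-overlap v w r z eqr (ℤ.<⇒≤ z<r) t<L)))
      (sym (eqf z l≤z z<r))
    ... | yes _ | no  z≮r = win u v z z (λ {t} t<L → splice-agreeˡ {l} {r} v w
      (λ _ z+t<r → contradiction (ℤ.≤-<-trans (ℤ.i≤i+j z (+ t)) z+t<r) z≮r))
    ... | no l≰z | _ = win u v z z (λ t<L → splice-agreeˡ {l} {r} v w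
      (λ l≤z+t _ → window-overlap v w l z eql (ℤ.<⇒≤ (ℤ.≰⇒> l≰z)) t<L l≤z+t))

    images : f u ≗ f v
    images z = subst (λ x → f u x ≡ f v x) ([z-k]+k z k) (images′ (z - k))

  -- The bound `K` is uniform in `v`, `w` and `x`; this is what stands in for compactness.
  AgreeingWindow : ℕ → ℤ → ℕ → (Config A → Config A) → Set
  AgreeingWindow K k L f = ∀ v w x →
    (∀ {y} → y < K → f v (x + + y + k) ≡ f w (x + + y + k)) →
    ∃[ q ] (q < K × (∀ {t} → t < L → v (x + + q + + t) ≡ w (x + + q + + t)))

  -- The search from `- K` finds a window starting before 0, the search from 1 one starting after 0,
  -- so 0 lies between the two starts. Both searches and the gap between them stay within the 2K + 1
  -- positions from -K to K.
  agree-at-0 : ∀ {f k L} K → Windowed k L f → Injective f → AgreeingWindow K k L f →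
    ∀ v w → (∀ {y} → y < suc (K ℕ.+ K) → f v (- + K + + y + k) ≡ f w (- + K + + y + k)) →
    v 0ℤ ≡ w 0ℤ
  agree-at-0 {f} {k} K win inj windows v w eq
    with windows v w (- + K) (λ y<K → eq (ℕ.m<n⇒m<1+n (ℕ.<-≤-trans y<K (ℕ.m≤m+n K K))))
       | windows v w 1ℤ (λ {y} y<K → subst (λ z → f v (z + k) ≡ f w (z + k)) (lemma y)
           (eq (ℕ.s≤s (ℕ.+-monoʳ-≤ K y<K))))
    where
    cancel : ∀ K y → - K + (K + y) ≡ y
    cancel = solve-∀
    lemma : ∀ y → - + K + + (K ℕ.+ suc y) ≡ 1ℤ + + y
    lemma y = cancel (+ K) (+ suc y)
  ... | q , q<K , eql | r , r<K , eqr =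
    agree-between win inj v w (- + K + + q) (1ℤ + + r) eql eqr between 0ℤ l≤0 (ℤ.+<+ ℕ.z<s)
    where
    l≤0 : - + K + + q ℤ.≤ 0ℤ
    l≤0 = subst (- + K + + q ℤ.≤_) (ℤ.+-inverseˡ (+ K))
            (ℤ.+-monoʳ-≤ (- + K) (ℤ.+≤+ (ℕ.<⇒≤ q<K)))

    cancel : ∀ K y → - K + y + K ≡ y
    cancel = solve-∀

    between : ∀ z → - + K + + q ℤ.≤ z → z ℤ.< 1ℤ + + r → f v (z + k) ≡ f w (z + k)
    between z l≤z z<r with ≤⇒+ (ℤ.≤-trans (ℤ.i≤i+j (- + K) (+ q)) l≤z)
    ... | y , refl = eq (ℤ.drop‿+<+ (ℤ.<-≤-trans y<r+K (ℤ.+≤+ 1+r+K≤1+K+K)))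
      where
      y<r+K : + y ℤ.< + suc r + + K
      y<r+K = subst (ℤ._< + suc r + + K) (cancel (+ K) (+ y)) (ℤ.+-monoˡ-< (+ K) z<r)
      1+r+K≤1+K+K : suc r ℕ.+ K ≤ suc (K ℕ.+ K)
      1+r+K≤1+K+K = ℕ.m≤n⇒m≤1+n (ℕ.+-monoˡ-≤ K r<K)

  agree-on-list : ∀ {f k L} K → Windowed k L f → Injective f → AgreeingWindow K k L f →
    ∃[ W ] (∀ v w → (∀ z → z ∈ W → f v z ≡ f w z) → v 0ℤ ≡ w 0ℤ)
  agree-on-list {k = k} K win inj windows = map position (upTo (suc (K ℕ.+ K))) , λ v w eq →
    agree-at-0 K win inj windows v w (λ y< → eq _ (∈-map⁺ position (∈-upTo⁺ y<)))
    where
    position : ℕ → ℤ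
    position y = - + K + + y + k

  module _ {m : ℕ} (A↔Fin : A ↔ Fin (suc m)) where

    -- The two windows share one code, so that a repeated code is a repetition in `v` and `w` at the
    -- same two places.
    encode : (L : ℕ) → Config A → Config A → ℤ → Fin ((suc m ^ L) ℕ.* (suc m ^ L))
    encode L v w i = combine (code v) (code w)
      where
      code : Config A → Fin (suc m ^ L)
      code v = funToFin (λ t → Inverse.to A↔Fin (v (i + + (toℕ {L} t))))

    code-injective : ∀ {L} (a b : Fin L → A) →
      funToFin (Inverse.to A↔Fin ∘ a) ≡ funToFin (Inverse.to A↔Fin ∘ b) → a ≗ b
    code-injective a b eq t = begin
      a t                                          ≡⟨ Inverse.strictlyInverseʳ A↔Fin (a t) ⟨
      from (to (a t))                              ≡⟨ cong from (finToFun-funToFin (to ∘ a) t) ⟨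
      from (finToFun (funToFin (to ∘ a)) t)        ≡⟨ cong (λ c → from (finToFun c t)) eq ⟩
      from (finToFun (funToFin (to ∘ b)) t)        ≡⟨ cong from (finToFun-funToFin (to ∘ b) t) ⟩
      from (to (b t))                              ≡⟨ Inverse.strictlyInverseʳ A↔Fin (b t) ⟩
      b t                                          ∎
      where
      open ≡-Reasoning
      open Inverse A↔Fin using (to; from)

    encode-injective : ∀ {L v w i j} → encode L v w i ≡ encode L v w j →
      (∀ {t} → t < L → v (i + + t) ≡ v (j + + t)) ×
      (∀ {t} → t < L → w (i + + t) ≡ w (j + + t))
    encode-injective {L} {v} {w} {i} {j} eq with combine-injective _ _ _ _ eq
    ... | eqv , eqw = window v eqv , window w eqw
      where
      window : ∀ v → _ ≡ _ → ∀ {t} → t < L → v (i + + t) ≡ v (j + + t)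
      window v eq t<L = subst (λ t → v (i + + t) ≡ v (j + + t)) (toℕ-fromℕ< t<L)
        (code-injective (λ t → v (i + + toℕ t)) (λ t → v (j + + toℕ t)) eq (fromℕ< t<L))

    -- Among the `K + 1` offsets from 0 to `K`, two carry the same pair of windows. The left one is
    -- the window sought, and the images are compared only at offsets below the right one, hence
    -- below `K`.
    agreeing-window : ∀ {f k L} → Windowed k L f → Injective f →
      ∃[ K ] AgreeingWindow K k L f
    agreeing-window {f} {k} {L} win inj = K , windows
      where
      -- the number of pairs of windows
      K = (suc m ^ L) ℕ.* (suc m ^ L)

      windows : AgreeingWindow K k L f
      windows v w x eqf with pigeonhole (ℕ.n<1+n K) (λ (i : Fin (suc K)) → encode L v w (x + + toℕ i))
      ... | i , j , i<j , eq with ℕ.m≤n⇒∃[o]m+o≡n i<j | encode-injective {L} {v} {w} {x + + toℕ i} {x + + toℕ j} eq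
      ... | o , 1+i+o≡j | eqv , eqw = toℕ i , i<K ,
        -- The period is the distance from `i` to `j`; written as `suc o`, it is visibly nonzero.
        repetition⇒agree win inj v w (x + + toℕ i) (suc o)
          (λ t<L → trans (eqv t<L) (cong (λ z → v (z + _)) j≡))
          (λ t<L → trans (eqw t<L) (cong (λ z → w (z + _)) j≡))
          (λ {y} y<p → subst (λ z → f v (z + k) ≡ f w (z + k)) (sym (ℤ.+-assoc x (+ toℕ i) (+ y)))
             (eqf (ℕ.<-≤-trans (ℕ.+-monoʳ-< (toℕ i) y<p) (ℕ.≤-trans (ℕ.≤-reflexive i+p≡j) (ℕ.s≤s⁻¹ (toℕ<n j))))))
        where
        i+p≡j : toℕ i ℕ.+ suc o ≡ toℕ j
        i+p≡j = trans (ℕ.+-suc (toℕ i) o) 1+i+o≡j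
        i<K : toℕ i < K
        i<K = ℕ.<-≤-trans i<j (ℕ.s≤s⁻¹ (toℕ<n j))
        j≡ : x + + toℕ j ≡ x + + toℕ i + + suc o
        j≡ = trans (cong (λ n → x + + n) (sym i+p≡j)) (sym (ℤ.+-assoc x (+ toℕ i) (+ suc o)))

    -- Unfolding the exponential bound K must be avoided from here on.
    abstract
      image-determines : ∀ {f} → IsCellularAutomaton f → Injective f →
        ∃[ W ] (∀ v w → (∀ z → z ∈ W → f v z ≡ f w z) → v 0ℤ ≡ w 0ℤ)
      image-determines {f} ca inj =
        let k , L , win = windowed ca
            K , windows = agreeing-window win inj
        in agree-on-list K win inj windows

-- Semilocalizability as overwriting

module _ {A B C D : Setoid 0ℓ 0ℓ} (F : Inverse (A ×ₛ B) (C ×ₛ D)) where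

  private
    module A = Setoid A
    module B = Setoid B
    module C = Setoid C
    module D = Setoid D
    module AB = Setoid (A ×ₛ B)
    module CD = Setoid (C ×ₛ D)
    module F = Inverse F

  -- F⁻¹ ∘ (overwrite C) ∘ F acts on A alone.
  OverwritesWithin : Set
  OverwritesWithin = ∀ {a a′} b b′ c → a A.≈ a′ →
    F.from (c , proj₂ (F.to (a , b))) AB.≈
      (proj₁ (F.from (c , proj₂ (F.to (a′ , b′)))) , b)

  -- By `factor`, replacing `a` by the preimage under `g` of `c` and the old E-component yields `c`
  -- and leaves the D-component alone. That preimage is computed without `b`.
  semilocalizable⇒overwritesWithin : Semilocalizable F → OverwritesWithin
  semilocalizable⇒overwritesWithin sl {a} {a′} b b′ c a≈a′ =
    AB.trans (overwrite a b c)
      ( A.trans (g.from-cong (C.refl , proj₂ (g.to-cong a≈a′))) (A.sym (proj₁ (overwrite a′ b′ c)))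
      , B.refl )
    where
    open Semilocalizable sl
    module g = Inverse g
    module h = Inverse h

    overwrite : ∀ a b c →
      F.from (c , proj₂ (F.to (a , b))) AB.≈ (g.from (c , proj₂ (g.to a)) , b)
    overwrite a b c = F.inverseʳ
      ( C.sym (C.trans (proj₁ eq) (proj₁ g-eq))
      , D.trans (proj₂ (factor a b))
          (D.sym (D.trans (proj₂ eq) (h.from-cong (B.refl , proj₂ g-eq)))) )
      where
      eq   = factor (g.from (c , proj₂ (g.to a))) b
      g-eq = g.strictlyInverseˡ (c , proj₂ (g.to a))

  -- The set E is A, with a and a′ identified when F (a , -) and F (a′ , -)
  -- have the same D-component.
  overwritesWithin⇒semilocalizable :
    B.Carrier → C.Carrier → OverwritesWithin → Semilocalizable F
  overwritesWithin⇒semilocalizable b₀ c₀ ow = record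
    { E = record
        { Carrier = A.Carrier
        ; _≈_ = λ e e′ → ∀ b → δ e b D.≈ δ e′ b
        ; isEquivalence = record
            { refl  = λ _ → D.refl
            ; sym   = λ p b → D.sym (p b)
            ; trans = λ p q b → D.trans (p b) (q b)
            }
        }
    ; g = record
        { to        = λ a → γ a b₀ , a
        ; from      = λ (c , e) → ψ c e
        ; to-cong   = λ a≈ → proj₁ (F.to-cong (a≈ , B.refl)) , λ b → δ-congˡ a≈
        ; from-cong = λ (c≈ , e≈) → proj₁ (F.from-cong (c≈ , e≈ b₀))
        ; inverse   =
            (λ {(c , e)} x≈ →
                C.trans (proj₁ (F.to-cong (x≈ , B.refl))) (proj₁ (to-ψ c e b₀))
              , λ b → D.trans (δ-congˡ x≈) (proj₂ (to-ψ c e b)))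
          , (λ (c≈ , e≈) → proj₁ (F.inverseʳ (c≈ , e≈ b₀)))
        }
    ; h = record
        -- The choice of `c₀` is immaterial: by `ow`, another value gives the same B-component and
        -- moves the A-component only within its class in E.
        { to        = λ d → proj₂ (F.from (c₀ , d)) , proj₁ (F.from (c₀ , d))
        ; from      = λ (b , e) → δ e b
        ; to-cong   = λ d≈ → let a≈ , b≈ = F.from-cong (C.refl , d≈) in
                        b≈ , λ b → δ-congˡ a≈
        ; from-cong = λ {(b , e)} {(b′ , e′)} (b≈ , e≈) →
                        D.trans (e≈ b) (proj₂ (F.to-cong (A.refl , b≈)))
        ; inverse   =
            (λ {(b , e)} d≈ →
              let a≈ , b≈ = AB.trans (F.from-cong (C.refl , d≈)) (ow b b₀ c₀ A.refl) in
              b≈ , λ b′ → D.trans (δ-congˡ a≈) (proj₂ (to-ψ c₀ e b′)))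
          , (λ {d} {(b , e)} (b≈ , e≈) →
              D.trans (e≈ b) (D.trans (proj₂ (F.to-cong (A.refl , b≈)))
                (proj₂ (F.strictlyInverseˡ (c₀ , d)))))
        }
    ; factor = λ a b → γ-constant a b , D.refl
    }
    where
    γ : A.Carrier → B.Carrier → C.Carrier
    γ a b = proj₁ (F.to (a , b))

    δ : A.Carrier → B.Carrier → D.Carrier
    δ a b = proj₂ (F.to (a , b))

    ψ : C.Carrier → A.Carrier → A.Carrier
    ψ c a = proj₁ (F.from (c , δ a b₀))

    δ-congˡ : ∀ {a a′ b} → a A.≈ a′ → δ a b D.≈ δ a′ b
    δ-congˡ a≈ = proj₂ (F.to-cong (a≈ , B.refl))

    to-ψ : ∀ c e b → F.to (ψ c e , b) CD.≈ (c , δ e b)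
    to-ψ c e b = F.inverseˡ (AB.sym (ow b b₀ c A.refl))

    -- Overwriting the C-component of `F (a , b)` by its own value `c` changes nothing, so `a` is
    -- `ψ c a`, and `ψ c a` produces `c` whatever the B-component is.
    γ-constant : ∀ a b → γ a b C.≈ γ a b₀
    γ-constant a b = C.sym (C.trans (proj₁ (F.to-cong (a≈ψ , B.refl))) (proj₁ (to-ψ c a b₀)))
      where
      c = γ a b
      a≈ψ : a A.≈ ψ c a
      a≈ψ = A.trans (A.sym (proj₁ (F.strictlyInverseʳ (a , b)))) (proj₁ (ow b b₀ c A.refl))

-- Complements and sums of sets of integers

∁-complement : ∀ X {z} → ¬ ⟦ X ⟧ z → ⟦ ∁ X ⟧ z
∁-complement X {z} z∉X with X z
... | true  = z∉X _
... | false = _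

∁-disjoint : ∀ X {z} → ⟦ ∁ X ⟧ z → ¬ ⟦ X ⟧ z
∁-disjoint X {z} z∉X z∈X with X z
∁-disjoint X {z} () z∈X | true

⊕-comm : ∀ {P Q : Pred ℤ 0ℓ} → P ⊕ Q ⊆ Q ⊕ P
⊕-comm (p , q , Pp , Qq , z≡) = q , p , Qq , Pp , trans z≡ (ℤ.+-comm p q)

-- The first summand ranges over the finite list `W`; the second is then determined as the
-- difference.
⊕-decidableˡ : ∀ {P Q : Pred ℤ 0ℓ} {W} → P ⊆ (_∈ W) → Decidable P → Decidable Q →
               Decidable (P ⊕ Q)
⊕-decidableˡ {P} {Q} {W} P⊆W P? Q? z =
  map′ to from (Any.any? (λ p → P? p ×-dec Q? (z - p)) W)
  where
  p+[z-p] : ∀ p z → z ≡ p + (z - p)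
  p+[z-p] = solve-∀
  [p+q]-p : ∀ p q → q ≡ p + q - p
  [p+q]-p = solve-∀
  to : Any.Any (λ p → P p × Q (z - p)) W → (P ⊕ Q) z
  to any with find any
  ... | p , _ , Pp , Qq = p , z - p , Pp , Qq , p+[z-p] p z
  from : (P ⊕ Q) z → Any.Any (λ p → P p × Q (z - p)) W
  from (p , q , Pp , Qq , refl) = lose (P⊆W Pp) (Pp , subst Q ([p+q]-p p q) Qq)

⊕-decidableʳ : ∀ {P Q : Pred ℤ 0ℓ} {W} → Q ⊆ (_∈ W) → Decidable P → Decidable Q →
               Decidable (P ⊕ Q)
⊕-decidableʳ Q⊆W P? Q? z = map′ ⊕-comm ⊕-comm (⊕-decidableˡ Q⊆W Q? P? z)

-- Overwriting in configurations

module _ {A : Set} where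

  Agree : Pred ℤ 0ℓ → Config A → Config A → Set
  Agree P v w = ∀ z → P z → v z ≡ w z

  -- a and b are changed into a′ and b′ in the same way, and only inside D.
  Rewritten : Pred ℤ 0ℓ → (a a′ b b′ : Config A) → Set
  Rewritten D a a′ b b′ = ∀ z → (D z × a′ z ≡ b′ z) ⊎ (a z ≡ a′ z × b z ≡ b′ z)

  -- Overwriting D after f amounts to rewriting S before f, where the new
  -- values depend on the old ones in S only.
  Overwrites : Pred ℤ 0ℓ → Pred ℤ 0ℓ → BijectiveMap A → Set
  Overwrites D S f = ∀ {a a′ b b′} → Rewritten D a a′ b b′ →
    Agree S (from a) (from b) →
    Rewritten S (from a) (from a′) (from b) (from b′)
    where open Inverse f

  rewritten-⊆ : ∀ {D D′ a a′ b b′} → D ⊆ D′ → Rewritten D a a′ b b′ → Rewritten D′ a a′ b b′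
  rewritten-⊆ D⊆D′ rw z with rw z
  ... | inj₁ (z∈D , eq) = inj₁ (D⊆D′ z∈D , eq)
  ... | inj₂ eqs        = inj₂ eqs

  rewritten-trans : ∀ {D a a′ a″ b b′ b″} → Rewritten D a a′ b b′ → Rewritten D a′ a″ b′ b″ →
                    Rewritten D a a″ b b″
  rewritten-trans rw rw′ z with rw z | rw′ z
  ... | _               | inj₁ new        = inj₁ new
  ... | inj₁ (z∈D , eq) | inj₂ (eqa , eqb) = inj₁ (z∈D , trans (sym eqa) (trans eq eqb))
  ... | inj₂ (p , q)    | inj₂ (eqa , eqb) = inj₂ (trans p eqa , trans q eqb)

  rewritten-agree : ∀ {D S a a′ b b′} → Rewritten D a a′ b b′ → Agree S a b → Agree S a′ b′
  rewritten-agree rw eq z z∈S with rw z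
  ... | inj₁ (_ , eq′)   = eq′
  ... | inj₂ (eqa , eqb) = trans (sym eqa) (trans (eq z z∈S) eqb)

  split-inside : ∀ X a b {z} t → Inverse.from (split {A} X) (a , b) z ≡ a (z , t)
  split-inside X a b t = proj₁ (Inverse.strictlyInverseˡ (split {A} X) (a , b)) (_ , t)

  split-outside : ∀ X a b {z} t → Inverse.from (split {A} X) (a , b) z ≡ b (z , t)
  split-outside X a b t = proj₂ (Inverse.strictlyInverseˡ (split {A} X) (a , b)) (_ , t)

  onBlocks : (X Y : Subset) → BijectiveMap A →
    Inverse (Restricted A X ×ₛ Restricted A (∁ X)) (Restricted A Y ×ₛ Restricted A (∁ Y))
  onBlocks X Y f =
    Composition.inverse (Symmetry.inverse (split X)) (Composition.inverse f (split Y))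

  -- Pulling back `a′` amounts to overwriting the {0}-block of the image of `from a`. By `ow`, this
  -- keeps the values off `X`, and the new values on `X` depend on the old ones through `X` alone,
  -- where the two configurations agree.
  Q⇒overwrites : ∀ {X} {f : BijectiveMap A} → Q X ｛0｝ f → Overwrites ⟦ ｛0｝ ⟧ ⟦ X ⟧ f
  Q⇒overwrites {X} {f} q {a} {a′} {b} {b′} rw agree with rw 0ℤ
  -- Only coordinate 0 could have been rewritten, and it was not.
  ... | inj₂ (a≡ , b≡) = λ z → inj₂ (f.from-cong (λ x → proj₁ (unchanged x)) z
                                     , f.from-cong (λ x → proj₂ (unchanged x)) z)
    where
    module f = Inverse f
    unchanged : ∀ z → a z ≡ a′ z × b z ≡ b′ z
    unchanged z with rw z
    ... | inj₂ eqs = eqs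
    ... | inj₁ (z∈0 , _) with refl ← toWitness {a? = z ℤ.≟ 0ℤ} z∈0 = a≡ , b≡
  ... | inj₁ (_ , a′≡b′) = λ z → case T? (X z) of λ where
      (yes z∈X) → inj₁ (z∈X , (begin
        f.from a′ z
          ≡⟨ proj₁ (overwritten a a′ (λ x x∉0 → proj₁ (outside x x∉0))) (z , z∈X) ⟩
        proj₁ (F.from (on-0 a′ , rest (f.from a))) (z , z∈X)
          ≡⟨ proj₁ (ow {proj₁ (X↓ (f.from a))} {proj₁ (X↓ (f.from b))} _ (proj₂ (X↓ (f.from b)))
                      (on-0 a′) (λ (x , x∈X) → agree x x∈X)) (z , z∈X) ⟩
        proj₁ (F.from (on-0 a′ , rest (f.from b))) (z , z∈X)
          ≡⟨ proj₁ (F.from-cong {on-0 a′ , rest (f.from b)} {on-0 b′ , rest (f.from b)} (on-0-≡ , λ _ → refl)) (z , z∈X) ⟩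
        proj₁ (F.from (on-0 b′ , rest (f.from b))) (z , z∈X)
          ≡⟨ proj₁ (overwritten b b′ (λ x x∉0 → proj₂ (outside x x∉0))) (z , z∈X) ⟨
        f.from b′ z ∎))
      (no z∉X) → inj₂
        ( sym (fixed a a′ (λ x x∉0 → proj₁ (outside x x∉0)) (∁-complement X z∉X))
        , sym (fixed b b′ (λ x x∉0 → proj₂ (outside x x∉0)) (∁-complement X z∉X)) )
    where
    open ≡-Reasoning
    module f = Inverse f
    X↓ = Inverse.to (split {A} X)
    Y↓ = Inverse.to (split {A} ｛0｝)
    module F = Inverse (onBlocks X ｛0｝ f)

    ow : OverwritesWithin (onBlocks X ｛0｝ f)
    ow = semilocalizable⇒overwritesWithin (onBlocks X ｛0｝ f) q

    on-0 : Config A → Setoid.Carrier (Restricted A ｛0｝)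
    on-0 c = proj₁ (Y↓ c)

    rest : Config A → Setoid.Carrier (Restricted A (∁ ｛0｝))
    rest v = proj₂ (F.to (X↓ v))

    on-0-≡ : on-0 a′ ≗ on-0 b′
    on-0-≡ (z , z∈0) with refl ← toWitness {a? = z ℤ.≟ 0ℤ} z∈0 = a′≡b′

    outside : ∀ z → ⟦ ∁ ｛0｝ ⟧ z → a z ≡ a′ z × b z ≡ b′ z
    outside z z∉0 with rw z
    ... | inj₁ (z∈0 , _) = contradiction z∈0 (∁-disjoint ｛0｝ z∉0)
    ... | inj₂ eqs       = eqs

    overwritten : ∀ c c′ → (∀ z → ⟦ ∁ ｛0｝ ⟧ z → c z ≡ c′ z) →
      Setoid._≈_ (Restricted A X ×ₛ Restricted A (∁ X))
        (X↓ (f.from c′)) (F.from (on-0 c′ , rest (f.from c)))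
    overwritten c c′ eq = (λ (z , _) → f.from-cong c′≗ z) , (λ (z , _) → f.from-cong c′≗ z)
      where
      c≗ : ∀ z → Inverse.from (split X) (X↓ (f.from c)) z ≡ f.from c z
      c≗ = Inverse.strictlyInverseʳ (split X) (f.from c)
      c′≗ : c′ ≗ Inverse.from (split ｛0｝) (on-0 c′ , rest (f.from c))
      c′≗ z = case T? (｛0｝ z) of λ where
        (yes z∈0) → sym (split-inside ｛0｝ (on-0 c′) (rest (f.from c)) z∈0)
        (no  z∉0) → let z∈∁0 = ∁-complement ｛0｝ z∉0 in
          trans (sym (trans (trans (f.to-cong c≗ z) (f.strictlyInverseˡ c z)) (eq z z∈∁0)))
                (sym (split-outside ｛0｝ (on-0 c′) (rest (f.from c)) z∈∁0))

    fixed : ∀ c c′ → (∀ z → ⟦ ∁ ｛0｝ ⟧ z → c z ≡ c′ z) →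
            ∀ {z} → ⟦ ∁ X ⟧ z → f.from c′ z ≡ f.from c z
    fixed c c′ eq z∉X = trans
      (proj₂ (overwritten c c′ eq) (_ , z∉X))
      (proj₂ (ow {proj₁ (X↓ (f.from c))} {proj₁ (X↓ (f.from c))} (proj₂ (X↓ (f.from c))) (proj₂ (X↓ (f.from c)))
        (on-0 c′) (λ _ → refl)) (_ , z∉X))

  -- Two inputs with the same X-block receive the same letter at 0. The rewriting before `f` then
  -- gives equal new X-blocks and keeps everything off `X`. The letter `x₀` supplies the reference
  -- points `b₀` and `c₀`.
  overwrites⇒Q : ∀ {X} {f : BijectiveMap A} → A → Overwrites ⟦ ｛0｝ ⟧ ⟦ X ⟧ f → Q X ｛0｝ f
  overwrites⇒Q {X} {f} x₀ ov =
    overwritesWithin⇒semilocalizable (onBlocks X ｛0｝ f) (λ _ → x₀) (λ _ → x₀) λ {a} {a′} b b′ c a≈a′ →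
      let u  = before (a , b)
          u′ = before (a′ , b′)
          agree : Agree ⟦ X ⟧ (f.from (f.to u)) (f.from (f.to u′))
          agree z z∈X = trans (f.strictlyInverseʳ u z) (trans (split-inside X a b z∈X)
            (trans (a≈a′ (z , z∈X)) (sym (trans (f.strictlyInverseʳ u′ z) (split-inside X a′ b′ z∈X)))))
          rw = ov (rewritten c (f.to u) (f.to u′)) agree
      in (λ (z , z∈X) → rewritten-agree {S = ⟦ X ⟧} rw agree z z∈X)
       , (λ (z , z∉X) → case rw z of λ where
            (inj₁ (z∈X , _)) → contradiction z∈X (∁-disjoint X z∉X)
            (inj₂ (eq , _))  → trans (sym eq) (trans (f.strictlyInverseʳ u z) (split-outside X a b z∉X)))
    where
    module f = Inverse f
    before = Inverse.from (split {A} X)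
    overwrite : Setoid.Carrier (Restricted A ｛0｝) → Config A → Config A
    overwrite c v = Inverse.from (split {A} ｛0｝) (c , v ∘ proj₁)

    rewritten : ∀ c v w → Rewritten ⟦ ｛0｝ ⟧ v (overwrite c v) w (overwrite c w)
    rewritten c v w z = case T? (｛0｝ z) of λ where
      (yes z∈0) → inj₁ (z∈0 , trans (split-inside ｛0｝ c (v ∘ proj₁) z∈0)
                                    (sym (split-inside ｛0｝ c (w ∘ proj₁) z∈0)))
      (no  z∉0) → let z∈∁0 = ∁-complement ｛0｝ z∉0 in
        inj₂ ( sym (split-outside ｛0｝ c (v ∘ proj₁) z∈∁0)
             , sym (split-outside ｛0｝ c (w ∘ proj₁) z∈∁0) )

  -- Cellular automata: composition, inverse and dual

  determines-at : ∀ {P} {f : Config A → Config A} → (∀ k v → f (shift k v) ≗ shift k (f v)) →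
    Determines P f → ∀ v w z → (∀ p → P p → v (z + p) ≡ w (z + p)) → f v z ≡ f w z
  determines-at {P} {f} ti det v w z eq = begin
    f v z                ≡⟨ cong (f v) (ℤ.+-identityˡ z) ⟨
    f v (0ℤ + z)         ≡⟨ ti z v 0ℤ ⟨
    f (shift z v) 0ℤ     ≡⟨ det _ _ (λ p Pp → subst (λ x → v x ≡ w x) (ℤ.+-comm z p) (eq p Pp)) ⟩
    f (shift z w) 0ℤ     ≡⟨ ti z w 0ℤ ⟩
    f w (0ℤ + z)         ≡⟨ cong (f w) (ℤ.+-identityˡ z) ⟩
    f w z                ∎
    where open ≡-Reasoning

  isCA-id : IsCellularAutomaton {A} (λ v → v)
  isCA-id = record
    { translation-invariant = λ _ _ _ → refl
    ; local = (0ℤ ∷ []) , λ v w eq → eq 0ℤ (here refl)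
    }

  isCA-∘ : ∀ {f g : Config A → Config A} → IsCellularAutomaton f → IsCellularAutomaton g →
           (∀ {v w} → v ≗ w → g v ≗ g w) → IsCellularAutomaton (g ∘ f)
  isCA-∘ {f} {g} cf cg g-cong = record
    { translation-invariant = λ k v z →
        trans (g-cong (translation-invariant cf k v) z) (translation-invariant cg k (f v) z)
    ; local = let W , det = local cf ; W′ , det′ = local cg in
        cartesianProductWith _+_ W′ W , λ v w eq →
          det′ (f v) (f w) λ x x∈W′ →
            determines-at (translation-invariant cf) det v w x λ p p∈W →
              eq (x + p) (∈-cartesianProductWith⁺ _+_ x∈W′ p∈W)
    }
    where open IsCellularAutomaton

  isCA-composeList : ∀ {fs : List (BijectiveMap A)} → All (IsCellularAutomaton ∘ Inverse.to) fs →
                     IsCellularAutomaton (Inverse.to (composeList fs))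
  isCA-composeList []         = isCA-id
  isCA-composeList {fs = f ∷ fs} (cf ∷ cfs) =
    isCA-∘ cf (isCA-composeList cfs) (Inverse.to-cong (composeList fs))

  from-translation-invariant : ∀ {f : BijectiveMap A} → IsCellularAutomaton (Inverse.to f) →
    ∀ k v → Inverse.from f (shift k v) ≗ shift k (Inverse.from f v)
  from-translation-invariant {f} ca k v = inverseʳ λ z →
    trans (sym (strictlyInverseˡ v (z + k))) (sym (translation-invariant k (from v) z))
    where
    open Inverse f
    open IsCellularAutomaton ca

  neighborhood-⊆ : ∀ {f X W} → IsNeighborhood {A} f X → Determines (_∈ W) f → ⟦ X ⟧ ⊆ (_∈ W)
  neighborhood-⊆ {W = W} (_ , least) det z∈X =
    toWitness (least (λ z → ⌊ z ∈? W ⌋) (λ v w eq → det v w λ z z∈W → eq z (fromWitness z∈W)) z∈X)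

  -- `image-determines` is applied to preimages, whose images are the given configurations; the
  -- reflections turn `W` into its negative.
  dual-local : ∀ {m} → A ↔ Fin (suc m) → ∀ {f : BijectiveMap A} → IsCellularAutomaton (Inverse.to f) →
               ∃[ W ] Determines (_∈ W) (dual f)
  dual-local A↔Fin {f} ca =
    let W , det = image-determines A↔Fin ca (λ {v} {w} eq z → trans (sym (strictlyInverseʳ v z)) (trans (from-cong eq z) (strictlyInverseʳ w z)))
    in map -_ W , λ v w eq → det _ _ λ z z∈W →
         trans (strictlyInverseˡ (reflect v) z) (trans (eq (- z) (∈-map⁺ -_ z∈W)) (sym (strictlyInverseˡ (reflect w) z)))
    where open Inverse f

  -- By translation, the value of the inverse at `z` is a value of the dual that reads the
  -- configuration at the positions `z - x` with `x` in `P`. Position 0 is among them only if `z` is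
  -- in `P`.
  dual-determines⇒unchanged : ∀ {P} {f : BijectiveMap A} → IsCellularAutomaton (Inverse.to f) →
    Determines P (dual f) → ∀ {a a′} → (∀ z → ¬ z ≡ 0ℤ → a z ≡ a′ z) →
    ∀ z → ¬ P z → Inverse.from f a z ≡ Inverse.from f a′ z
  dual-determines⇒unchanged {P} {f} ca det {a} {a′} eq z z∉P =
    trans (sym (at-z a)) (trans (det _ _ agree) (at-z a′))
    where
    open Inverse f
    open ≡-Reasoning

    at-z : ∀ c → dual f (reflect (shift z c)) 0ℤ ≡ from c z
    at-z c = begin
      from (reflect (reflect (shift z c))) 0ℤ
        ≡⟨ from-cong (λ x → cong (shift z c) (ℤ.neg-involutive x)) 0ℤ ⟩
      from (shift z c) 0ℤ
        ≡⟨ from-translation-invariant {f} ca z c 0ℤ ⟩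
      from c (0ℤ + z)
        ≡⟨ cong (from c) (ℤ.+-identityˡ z) ⟩
      from c z ∎

    x≡z : ∀ {x} → - x + z ≡ 0ℤ → x ≡ z
    x≡z {x} e = begin
      x              ≡⟨ ℤ.+-identityʳ x ⟨
      x + 0ℤ         ≡⟨ cong (_+_ x) e ⟨
      x + (- x + z)  ≡⟨ cancel x z ⟩
      z              ∎
      where
      cancel : ∀ x z → x + (- x + z) ≡ z
      cancel = solve-∀

    agree : ∀ x → P x → reflect (shift z a) x ≡ reflect (shift z a′) x
    agree x Px = eq (- x + z) (λ e → z∉P (subst P (x≡z e) Px))

  -- From overwriting one cell to overwriting a finite set

  overwrites-shift : ∀ {S} {f : BijectiveMap A} → IsCellularAutomaton (Inverse.to f) →
    Overwrites ⟦ ｛0｝ ⟧ S f → ∀ d → Overwrites (_≡ d) ((_≡ d) ⊕ S) f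
  overwrites-shift {S} {f} ca ov d {a} {a′} {b} {b′} rw agree z =
    at-d (rewritten (z - d))
    where
    open Inverse f

    [z+d]-d : ∀ z d → z + d - d ≡ z
    [z+d]-d = solve-∀

    rw₀ : Rewritten ⟦ ｛0｝ ⟧ (shift d a) (shift d a′) (shift d b) (shift d b′)
    rw₀ z with rw (z + d)
    ... | inj₂ eqs         = inj₂ eqs
    ... | inj₁ (z+d≡d , e) = inj₁ (fromWitness z≡0 , e)
      where
      z≡0 : z ≡ 0ℤ
      z≡0 = trans (sym ([z+d]-d z d)) (ℤ.i≡j⇒i-j≡0 z+d≡d)

    agree₀ : Agree S (from (shift d a)) (from (shift d b))
    agree₀ z z∈S = trans (from-translation-invariant {f} ca d a z)
      (trans (agree (z + d) (d , z , refl , z∈S , ℤ.+-comm z d))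
             (sym (from-translation-invariant {f} ca d b z)))

    rewritten : Rewritten S (from (shift d a)) (from (shift d a′)) (from (shift d b)) (from (shift d b′))
    rewritten = ov rw₀ agree₀

    at-z : ∀ c → from (shift d c) (z - d) ≡ from c z
    at-z c = trans (from-translation-invariant {f} ca d c (z - d)) (cong (from c) ([z-k]+k z d))

    along : ∀ {c c′} → from (shift d c) (z - d) ≡ from (shift d c′) (z - d) → from c z ≡ from c′ z
    along {c} {c′} eq = trans (sym (at-z c)) (trans eq (at-z c′))

    at-d : _ → (((_≡ d) ⊕ S) z × from a′ z ≡ from b′ z) ⊎ (from a z ≡ from a′ z × from b z ≡ from b′ z)
    at-d (inj₁ (z-d∈S , eq)) =
      inj₁ ((d , z - d , refl , z-d∈S , trans (sym ([z-k]+k z d)) (ℤ.+-comm (z - d) d)) , along eq)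
    at-d (inj₂ (eqa , eqb)) = inj₂ (along eqa , along eqb)

  update : ℤ → (v v′ : Config A) → Config A
  update d v v′ z with z ℤ.≟ d
  ... | yes _ = v′ z
  ... | no  _ = v z

  update-first : ∀ {D a a′ b b′} d → Rewritten D a a′ b b′ →
                 Rewritten (_≡ d) a (update d a a′) b (update d b b′)
  update-first d rw z with z ℤ.≟ d
  ... | no  _   = inj₂ (refl , refl)
  ... | yes z≡d with rw z
  ...   | inj₁ (_ , eq) = inj₁ (z≡d , eq)
  ...   | inj₂ eqs      = inj₂ eqs

  update-rest : ∀ {ds a a′ b b′} d → Rewritten (_∈ (d ∷ ds)) a a′ b b′ →
                Rewritten (_∈ ds) (update d a a′) a′ (update d b b′) b′
  update-rest d rw z with z ℤ.≟ d
  ... | yes _   = inj₂ (refl , refl)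
  ... | no  z≢d with rw z
  ...   | inj₁ (here z≡d , _)    = contradiction z≡d z≢d
  ...   | inj₁ (there z∈ds , eq) = inj₁ (z∈ds , eq)
  ...   | inj₂ eqs               = inj₂ eqs

  -- The set `R` is kept fixed throughout the list: rewriting a cell preserves agreement on `R` by
  -- `rewritten-agree`, so the hypothesis is available again for the next cell.
  overwrites-list : ∀ {S R} {f : BijectiveMap A} → IsCellularAutomaton (Inverse.to f) →
    Overwrites ⟦ ｛0｝ ⟧ S f → ∀ ds → (∀ {d} → d ∈ ds → (_≡ d) ⊕ S ⊆ R) →
    Overwrites (_∈ ds) R f
  overwrites-list {f = f} ca ov [] _ rw _ z =
    inj₂ (from-cong (λ x → proj₁ (unchanged x)) z , from-cong (λ x → proj₂ (unchanged x)) z)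
    where
    open Inverse f
    unchanged : ∀ x → _ × _
    unchanged x with rw x
    ... | inj₂ eqs = eqs
  overwrites-list {S} {R} {f} ca ov (d ∷ ds) ds+S⊆R {a} {a′} {b} {b′} rw agree =
    rewritten-trans first (overwrites-list {f = f} ca ov ds (λ d∈ds → ds+S⊆R (there d∈ds))
      (update-rest d rw) (rewritten-agree first agree))
    where
    open Inverse f
    first : Rewritten R (from a) (from (update d a a′)) (from b) (from (update d b b′))
    first = rewritten-⊆ (ds+S⊆R (here refl))
      (overwrites-shift {f = f} ca ov d (update-first d rw) (λ z z∈d+S → agree z (ds+S⊆R (here refl) z∈d+S)))

  overwrites-finite : ∀ {P S W} {f : BijectiveMap A} → IsCellularAutomaton (Inverse.to f) →
    Overwrites ⟦ ｛0｝ ⟧ S f → Decidable P → P ⊆ (_∈ W) → Overwrites P (P ⊕ S) f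
  overwrites-finite {P} {S} {W} {f} ca ov P? P⊆W rw agree =
    -- `W` may contain cells outside `P`; filtering keeps the changes within `P ⊕ S`.
    overwrites-list {f = f} ca ov (filter P? W) d+S⊆P⊕S
      (rewritten-⊆ (λ Pz → ∈-filter⁺ P? (P⊆W Pz) Pz) rw) agree
    where
    d+S⊆P⊕S : ∀ {d} → d ∈ filter P? W → (_≡ d) ⊕ S ⊆ P ⊕ S
    d+S⊆P⊕S d∈ (_ , q , refl , Sq , z≡) = _ , q , proj₂ (∈-filter⁻ P? {xs = W} d∈) , Sq , z≡

  -- The first `j` maps cancel the inverses that were applied last. This carries agreement before
  -- all maps over to agreement at an intermediate stage.
  take-from-composeList : ∀ j (fs : List (BijectiveMap A)) a →
    Inverse.to (composeList (take j fs)) (Inverse.from (composeList fs) a) ≗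
    Inverse.from (composeList (drop j fs)) a
  take-from-composeList zero    fs       a z = refl
  take-from-composeList (suc j) []       a z = refl
  take-from-composeList (suc j) (f ∷ fs) a z = trans
    (Inverse.to-cong (composeList (take j fs)) (Inverse.strictlyInverseˡ f _) z)
    (take-from-composeList j fs a z)

  drop-tabulate-suc : ∀ {n} (f : Fin n → BijectiveMap A) k →
    drop (toℕ k) (tabulate f) ≡ f k ∷ drop (suc (toℕ k)) (tabulate f)
  drop-tabulate-suc f zero    = refl
  drop-tabulate-suc f (suc k) = drop-tabulate-suc (f ∘ suc) k

  drop-tabulate-all : ∀ {n} (f : Fin n → BijectiveMap A) → drop n (tabulate f) ≡ []
  drop-tabulate-all {zero}  f = refl
  drop-tabulate-all {suc n} f = drop-tabulate-all (f ∘ suc)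

  -- For a one-letter alphabet, 𝒩(id) is empty.
  id-determined-outside-0 : ∀ {P} → Determines {A} P (λ v → v) → ¬ P 0ℤ → ∀ (x y : A) → x ≡ y
  id-determined-outside-0 {P} det 0∉P x y = det v (λ _ → y) agree
    where
    v : Config A
    v z with z ℤ.≟ 0ℤ
    ... | yes _ = x
    ... | no  _ = y
    agree : Agree P v (λ _ → y)
    agree z Pz with z ℤ.≟ 0ℤ
    ... | yes refl = contradiction Pz 0∉P
    ... | no  _    = refl

-- The composition

module _ (A : Set) (m : ℕ) (A↔Fin : A ↔ Fin (suc m))
         {n : ℕ} (f : Fin (suc n) → BijectiveMap A)
         (ca : ∀ k → IsCellularAutomaton (Inverse.to (f k)))
         (Ñ BN N : Fin (suc n) → Subset)
         (isÑ : ∀ k → IsDualNeighborhood (composeAfter f k) (Ñ k))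
         (isBN : ∀ k → IsBlockNeighborhood (f k) (BN k))
         (isN : ∀ k → IsNeighborhood (Inverse.to (composeBefore f k)) (N k))
         where

  Inner U : Fin (suc n) → Pred ℤ 0ℓ
  Inner k = ⟦ Ñ k ⟧ ⊕ ⟦ BN k ⟧
  U k = Inner k ⊕ ⟦ N k ⟧

  Union : Pred ℤ 0ℓ
  Union = ⋃ (Fin (suc n)) U

  fs : List (BijectiveMap A)
  fs = tabulate f

  all-CA : All (IsCellularAutomaton ∘ Inverse.to) fs
  all-CA = All.tabulate⁺ {f = f} ca

  before-CA : ∀ k → IsCellularAutomaton (Inverse.to (composeBefore f k))
  before-CA k = isCA-composeList (All.take⁺ (toℕ k) all-CA)

  after-CA : ∀ k → IsCellularAutomaton (Inverse.to (composeAfter f k))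
  after-CA k = isCA-composeList (All.drop⁺ (suc (toℕ k)) all-CA)

  abstract
    Ñ-finite : ∀ k → ∃[ W ] ⟦ Ñ k ⟧ ⊆ (_∈ W)
    Ñ-finite k = let W , det = dual-local A↔Fin {composeAfter f k} (after-CA k) in
      W , neighborhood-⊆ {f = dual (composeAfter f k)} (isÑ k) det

    N-finite : ∀ k → ∃[ W ] ⟦ N k ⟧ ⊆ (_∈ W)
    N-finite k = let W , det = IsCellularAutomaton.local (before-CA k) in
      W , neighborhood-⊆ {f = Inverse.to (composeBefore f k)} (isN k) det

    Union? : Decidable Union
    Union? z = any? λ k →
      ⊕-decidableʳ (proj₂ (N-finite k))
        (⊕-decidableˡ (proj₂ (Ñ-finite k)) (T? ∘ Ñ k) (T? ∘ BN k)) (T? ∘ N k) z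

  pullback : List (BijectiveMap A) → Config A → Config A
  pullback gs = Inverse.from (composeList gs)

  module _ {a a′ b b′ : Config A} (rw : Rewritten ⟦ ｛0｝ ⟧ a a′ b b′)
           (agree : Agree Union (pullback fs a) (pullback fs b)) where

    RewrittenAt : Pred ℤ 0ℓ → List (BijectiveMap A) → Set
    RewrittenAt D gs = Rewritten D (pullback gs a) (pullback gs a′) (pullback gs b) (pullback gs b′)

    outside-0 : ∀ z → ¬ z ≡ 0ℤ → a z ≡ a′ z × b z ≡ b′ z
    outside-0 z z≢0 with rw z
    ... | inj₁ (z∈0 , _) = contradiction (toWitness z∈0) z≢0
    ... | inj₂ eqs       = eqs

    -- From the set `D` reached so far only the equality of the new values is kept. Outside `Ñ k`
    -- nothing changes, because `a` and `a′`, like `b` and `b′`, differ at most at 0. So the sets do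
    -- not accumulate from one map to the next.
    restrict-to-Ñ : ∀ {D} k → RewrittenAt D (drop (suc (toℕ k)) fs) →
                    RewrittenAt ⟦ Ñ k ⟧ (drop (suc (toℕ k)) fs)
    restrict-to-Ñ k rwD z with T? (Ñ k z) | rwD z
    ... | _        | inj₂ eqs      = inj₂ eqs
    ... | yes z∈Ñ  | inj₁ (_ , eq) = inj₁ (z∈Ñ , eq)
    ... | no  z∉Ñ  | inj₁ _        = inj₂
      ( unchanged (λ z z≢0 → proj₁ (outside-0 z z≢0)) z z∉Ñ
      , unchanged (λ z z≢0 → proj₂ (outside-0 z z≢0)) z z∉Ñ )
      where
      unchanged : ∀ {c c′} → _ → _
      unchanged {c} {c′} = dual-determines⇒unchanged {f = composeAfter f k} (after-CA k) (proj₁ (isÑ k)) {c} {c′}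

    -- The preceding maps, evaluated on `Inner k`, read the initial configuration only on `U k`,
    -- which is part of `Union`.
    agree-at : ∀ k → Agree (Inner k) (pullback (drop (toℕ k) fs) a) (pullback (drop (toℕ k) fs) b)
    agree-at k z z∈ = trans (sym (take-from-composeList (toℕ k) fs a z))
      (trans (determines-at {f = Inverse.to (composeBefore f k)} (IsCellularAutomaton.translation-invariant (before-CA k)) (proj₁ (isN k))
                (pullback fs a) (pullback fs b) z (λ p p∈N → agree (z + p) (k , z , p , z∈ , p∈N , refl)))
             (take-from-composeList (toℕ k) fs b z))

    step : ∀ {D} k → RewrittenAt D (drop (suc (toℕ k)) fs) → RewrittenAt (Inner k) (drop (toℕ k) fs)
    step k rwD = subst (RewrittenAt (Inner k)) (sym (drop-tabulate-suc f k))
      (overwrites-finite {f = f k} (ca k) (Q⇒overwrites {f = f k} (proj₁ (isBN k))) (T? ∘ Ñ k) (proj₂ (Ñ-finite k))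
        (restrict-to-Ñ k rwD)
        (subst (λ gs → Agree (Inner k) (pullback gs a) (pullback gs b)) (drop-tabulate-suc f k) (agree-at k)))

    rewrittenAt : ∀ k → RewrittenAt (Inner k) (drop (toℕ k) fs)
    rewrittenAt = >-weakInduction (λ k → RewrittenAt (Inner k) (drop (toℕ k) fs))
      -- The induction descends from the last map, after which no map remains to be undone.
      (step (fromℕ n) (subst (RewrittenAt ⟦ ｛0｝ ⟧) (sym last-drop) rw))
      (λ k rwk → step (inject₁ k)
        (subst (λ j → RewrittenAt (Inner (suc k)) (drop (suc j) fs)) (sym (toℕ-inject₁ k)) rwk))
      where
      last-drop : drop (suc (toℕ (fromℕ n))) fs ≡ []
      last-drop = trans (cong (λ j → drop (suc j) fs) (toℕ-fromℕ n)) (drop-tabulate-all f)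

    rewritten-Union : RewrittenAt Union fs
    -- `Inner zero` lies in `U zero` if 0 is in the neighborhood of the identity. Otherwise the
    -- alphabet has a single letter and nothing can change.
    rewritten-Union z with T? (N zero 0ℤ) | rewrittenAt zero z
    ... | _       | inj₂ eqs       = inj₂ eqs
    ... | yes 0∈N | inj₁ (z∈ , eq) =
      inj₁ ((zero , z , 0ℤ , z∈ , 0∈N , sym (ℤ.+-identityʳ z)) , eq)
    ... | no  0∉N | inj₁ _         = inj₂ (subsingleton _ _ , subsingleton _ _)
      where
      subsingleton : ∀ x y → x ≡ y
      subsingleton = id-determined-outside-0 (proj₁ (isN zero)) 0∉N

  composeAll-overwrites : Overwrites ⟦ ｛0｝ ⟧ Union (composeAll f)
  composeAll-overwrites = rewritten-Union

  Q-Union : Q (λ z → ⌊ Union? z ⌋) ｛0｝ (composeAll f)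
  Q-Union = overwrites⇒Q {f = composeAll f} (Inverse.from A↔Fin zero) λ rw agree →
    rewritten-⊆ (λ z∈ → fromWitness z∈) (composeAll-overwrites rw λ z z∈ → agree z (fromWitness z∈))

proposition2p3 : ∀ (A : Set) (m : ℕ) → A ↔ Fin (suc m) →
    ∀ (n : ℕ) .{{_ : NonZero n}} (f : Fin n → BijectiveMap A) →
    (∀ k → IsCellularAutomaton (Inverse.to (f k))) →
    ∀ (BNf : Subset) (Ñ BN N : Fin n → Subset) →
    IsBlockNeighborhood (composeAll f) BNf →
    (∀ k → IsDualNeighborhood (composeAfter f k) (Ñ k)) →
    (∀ k → IsBlockNeighborhood (f k) (BN k)) →
    (∀ k → IsNeighborhood (Inverse.to (composeBefore f k)) (N k)) →
    ⟦ BNf ⟧ ⊆ ⋃ (Fin n) (λ k → ⟦ Ñ k ⟧ ⊕ ⟦ BN k ⟧ ⊕ ⟦ N k ⟧)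
proposition2p3 A m A↔Fin (suc n) f ca BNf Ñ BN N (_ , least) isÑ isBN isN z∈BNf =
  toWitness (least _ (Q-Union A m A↔Fin {n} f ca Ñ BN N isÑ isBN isN) z∈BNf)
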